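{- Let $a\in\mathbb{Q}$ with $a\neq -8$, and suppose that $$f(x)=(4a+32)x^5+(-5a^2+5a)x-a^3+a^2$$ is irreducible over $\mathbb{Q}$. Let $\alpha$ be a root of $f(x)$. Then the number $$\frac{1}{a^2+4a-8}\left[\frac{4a^2+16a-128}{a^2-a}\alpha^4+\frac{8a+64}{a}\alpha^3+(-2a-16)\alpha^2+(2a+4)\alpha-4a+16\right]$$ is a root of $$(a^3+7a^2-8a)x^5+(10a^2+115a-125)x+2a^2-76a-250.$$ -}

module Defs where

open import Level using (Level; _⊔_)
open import Data.Nat as ℕ using (ℕ; zero; suc)
open import Data.Integer using (+_)
open import Data.Rational as ℚ using (ℚ; 0ℚ; 1/_; _/_)
open import Data.List using (List; []; _∷_; map; foldr)
open import Data.Product using (Σ; _×_)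
open import Data.Sum using (_⊎_)
open import Relation.Binary.PropositionalEquality using (_≡_; _≢_)
open import Relation.Nullary using (¬_; yes; no)
open import Algebra.Bundles using (CommutativeRing)

-- Rational numerals and a total inverse (inv 0 = 0; only ever applied
-- to values forced nonzero by the hypotheses of the theorem).

num : ℕ → ℚ
num n = + n / 1

inv : ℚ → ℚ
inv p with p ℚ.≟ 0ℚ
... | yes _ = 0ℚ
... | no p≢0 = 1/_ p {{ℚ.≢-nonZero p≢0}}

-- Polynomials over ℚ: coefficient lists, lowest degree first.

Poly : Set
Poly = List ℚ

coeff : Poly → ℕ → ℚ
coeff []       _       = 0ℚ
coeff (c ∷ p)  zero    = c
coeff (c ∷ p)  (suc n) = coeff p n

_+ₚ_ : Poly → Poly → Poly
[]      +ₚ q       = q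
(a ∷ p) +ₚ []      = a ∷ p
(a ∷ p) +ₚ (b ∷ q) = (a ℚ.+ b) ∷ (p +ₚ q)

_*ₚ_ : Poly → Poly → Poly
[]      *ₚ q = []
(a ∷ p) *ₚ q = map (a ℚ.*_) q +ₚ (0ℚ ∷ (p *ₚ q))

IsDegree : Poly → ℕ → Set
IsDegree p d = coeff p d ≢ 0ℚ × (∀ n → d ℕ.< n → coeff p n ≡ 0ℚ)

Irreducible : Poly → Set
Irreducible f =
  Σ ℕ (λ d → 1 ℕ.≤ d × IsDegree f d)
  × (∀ g h → (∀ n → coeff f n ≡ coeff (g *ₚ h) n) → IsDegree g 0 ⊎ IsDegree h 0)

IsField : ∀ {c ℓ} → CommutativeRing c ℓ → Set (c ⊔ ℓ)
IsField K = ¬ (1# ≈ 0#) × (∀ x → ¬ (x ≈ 0#) → Σ Carrier (λ y → x * y ≈ 1#))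
  where open CommutativeRing K

evalK : ∀ {c ℓ} (K : CommutativeRing c ℓ) → (ℚ → CommutativeRing.Carrier K)
        → Poly → CommutativeRing.Carrier K → CommutativeRing.Carrier K
evalK K φ p x = foldr (λ c acc → φ c + x * acc) 0# p
  where open CommutativeRing K

fPoly : ℚ → Poly
fPoly a = ((ℚ.- (a ℚ.* a ℚ.* a)) ℚ.+ a ℚ.* a) ∷ ((ℚ.- (num 5 ℚ.* a ℚ.* a)) ℚ.+ num 5 ℚ.* a)
          ∷ 0ℚ ∷ 0ℚ ∷ 0ℚ ∷ (num 4 ℚ.* a ℚ.+ num 32) ∷ []

gPoly : ℚ → Poly
gPoly a = (num 2 ℚ.* a ℚ.* a ℚ.+ (ℚ.- (num 76 ℚ.* a)) ℚ.+ (ℚ.- num 250))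
          ∷ (num 10 ℚ.* a ℚ.* a ℚ.+ num 115 ℚ.* a ℚ.+ (ℚ.- num 125))
          ∷ 0ℚ ∷ 0ℚ ∷ 0ℚ
          ∷ (a ℚ.* a ℚ.* a ℚ.+ num 7 ℚ.* a ℚ.* a ℚ.+ (ℚ.- (num 8 ℚ.* a))) ∷ []

βPoly : ℚ → Poly
βPoly a = (d ℚ.* ((ℚ.- (num 4 ℚ.* a)) ℚ.+ num 16))
          ∷ (d ℚ.* (num 2 ℚ.* a ℚ.+ num 4))
          ∷ (d ℚ.* ((ℚ.- (num 2 ℚ.* a)) ℚ.+ (ℚ.- num 16)))
          ∷ (d ℚ.* ((num 8 ℚ.* a ℚ.+ num 64) ℚ.* inv a))
          ∷ (d ℚ.* ((num 4 ℚ.* a ℚ.* a ℚ.+ num 16 ℚ.* a ℚ.+ (ℚ.- num 128)) ℚ.* inv (a ℚ.* a ℚ.+ (ℚ.- a))))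
          ∷ []
  where d = inv (a ℚ.* a ℚ.+ num 4 ℚ.* a ℚ.+ (ℚ.- num 8))

{-# OPTIONS --safe #-}

-- Put D = a² + 4a − 8 and E = a(a − 1)D, and let β be the number of the
-- theorem, so that B = E β is a polynomial in a and α with integer
-- coefficients.  Modulo f(α) the powers β² and β⁴ have the small
-- representatives E β² = N₂ and a E β⁴ = N₄, and
--   a E² g(β) = g₅ N₄ B + g₁ a E B + g₀ a E²
-- is a multiple of f(α).  The cofactors Q₁, Q₂, Q₃ of f(α) in these three
-- congruences come from division with remainder by f; once they are known,
-- what is left are identities of polynomials with rational coefficients.
-- Dividing by E is legitimate: for a = 0 and a = 1 the polynomial f is a
-- monomial of degree 5, hence reducible, and D = (a + 2)² − 12 has no
-- rational zero.

module Submission where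

open import Defs
open import Data.Rational using (ℚ; -_)
open import Relation.Binary.PropositionalEquality using (_≢_)
open import Algebra.Bundles using (CommutativeRing)
open import Data.Rational.Base using (+-*-rawRing)
open import Algebra.Morphism.Structures using (IsRingHomomorphism)
open import Algebra.Solver.Ring.AlmostCommutativeRing using (fromCommutativeRing; _-Raw-AlmostCommutative⟶_)
import Algebra.Solver.Ring
open import Data.Fin using (zero; suc)
open import Data.Integer as ℤ using (∣_∣)
import Data.Integer.Properties as ℤ
open import Data.List using (List; []; _∷_; foldr)
open import Data.List.Relation.Binary.Pointwise using (Pointwise; []; _∷_)
import Data.Maybe as Maybe
open import Data.Nat as ℕ using (ℕ; zero; suc)
open import Data.Nat.Coprimality using (coprime-divisor) renaming (sym to coprime-sym; recompute to coprime-recompute)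
open import Data.Nat.Divisibility using (_∣_; divides; ∣-refl)
import Data.Nat.Properties as ℕ
open import Data.Product using (_,_)
open import Data.Rational as ℚ using (0ℚ; 1ℚ; mkℚ)
import Data.Rational.Properties as ℚ
open import Data.Rational.Solver using (module +-*-Solver)
open import Data.Rational.Unnormalised as ℚᵘ using (*≡*)
open import Data.Sum using (inj₁; inj₂)
open import Data.Vec using (Vec; []; _∷_)
open import Relation.Binary.PropositionalEquality as ≡ using (_≡_; refl; module ≡-Reasoning)
open import Relation.Nullary using (¬_; yes; no; contradiction)
open import Relation.Nullary.Decidable using (dec⇒maybe)

-- Denominators that do not vanish over ℚ.

*-inv : ∀ p → p ≢ 0ℚ → p ℚ.* inv p ≡ 1ℚ
*-inv p p≢0 with p ℚ.≟ 0ℚ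
... | yes p≡0 = contradiction p≡0 p≢0
... | no  p≢0 = ℚ.*-inverseʳ p {{ℚ.≢-nonZero p≢0}}

-- 12 lies strictly between 3² and 4².
m*m≢12 : ∀ m → m ℕ.* m ≢ 12
m*m≢12 m m*m≡12 with m ℕ.≤? 3
... | yes m≤3 = contradiction (≡.subst (ℕ._≤ 9) m*m≡12 (ℕ.*-mono-≤ m≤3 m≤3)) (ℕ.<⇒≱ (ℕ.m≤m+n 10 2))
... | no  m≰3 = contradiction (≡.subst (16 ℕ.≤_) m*m≡12 (ℕ.*-mono-≤ (ℕ.≰⇒> m≰3) (ℕ.≰⇒> m≰3))) (ℕ.<⇒≱ (ℕ.m≤m+n 13 3))

-- For p = n/d in lowest terms, n² = 12d² makes d divide n² and so, by coprimality, n. Hence d = 1,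
-- and n² = 12 has no integer solution.
p*p≢12 : ∀ p → p ℚ.* p ≢ num 12
p*p≢12 p@(mkℚ n d-1 coprime) p*p≡12 = m*m≢12 ∣ n ∣ (begin
  ∣ n ∣ ℕ.* ∣ n ∣  ≡⟨ n²≡12d² ⟩
  12 ℕ.* (d ℕ.* d) ≡⟨ ≡.cong (λ k → 12 ℕ.* (k ℕ.* k)) d≡1 ⟩
  12               ∎)
  where
  open ≡-Reasoning
  d : ℕ
  d = suc d-1

  n²≡12d² : ∣ n ∣ ℕ.* ∣ n ∣ ≡ 12 ℕ.* (d ℕ.* d)
  -- Unnormalised fractions avoid the gcd hidden in `p ℚ.* p`: equality there is the
  -- cross-multiplied 12 · d² = n² · 1.
  n²≡12d² with ≡.subst (λ q → ℚ.toℚᵘ q ℚᵘ.≃ ℚ.toℚᵘ p ℚᵘ.* ℚ.toℚᵘ p) p*p≡12 (ℚ.toℚᵘ-homo-* p p)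
  ... | *≡* eq = begin
    ∣ n ∣ ℕ.* ∣ n ∣              ≡⟨ ℤ.abs-* n n ⟨
    ∣ n ℤ.* n ∣                  ≡⟨ ≡.cong ∣_∣ (ℤ.*-identityʳ (n ℤ.* n)) ⟨
    ∣ n ℤ.* n ℤ.* ℤ.1ℤ ∣         ≡⟨ ≡.cong ∣_∣ eq ⟨
    ∣ ℤ.+ 12 ℤ.* ℤ.+ (d ℕ.* d) ∣ ≡⟨ ℤ.abs-* (ℤ.+ 12) (ℤ.+ (d ℕ.* d)) ⟩
    12 ℕ.* (d ℕ.* d)             ∎

  d∣n : d ∣ ∣ n ∣
  -- The coprimality stored in `mkℚ` is irrelevant, so a usable proof is recomputed.
  d∣n = coprime-divisor {o = ∣ n ∣} (coprime-sym (coprime-recompute coprime))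
    (divides (12 ℕ.* d) (≡.trans n²≡12d² (≡.sym (ℕ.*-assoc 12 d d))))

  d≡1 : d ≡ 1
  d≡1 = coprime-recompute coprime (d∣n , ∣-refl)

a²+4a-8≢0 : ∀ a → a ℚ.* a ℚ.+ num 4 ℚ.* a ℚ.+ (- num 8) ≢ 0ℚ
a²+4a-8≢0 a D≡0 = p*p≢12 (a ℚ.+ num 2) (begin
  (a ℚ.+ num 2) ℚ.* (a ℚ.+ num 2)                       ≡⟨ complete-square a ⟩
  a ℚ.* a ℚ.+ num 4 ℚ.* a ℚ.+ (- num 8) ℚ.+ num 12      ≡⟨ ≡.cong (ℚ._+ num 12) D≡0 ⟩
  num 12                                                ∎)
  where
  open ≡-Reasoning
  open +-*-Solver
  complete-square : ∀ a → (a ℚ.+ num 2) ℚ.* (a ℚ.+ num 2) ≡ a ℚ.* a ℚ.+ num 4 ℚ.* a ℚ.+ (- num 8) ℚ.+ num 12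
  complete-square = solve 1 (λ a → (a :+ con (num 2)) :* (a :+ con (num 2))
    := a :* a :+ con (num 4) :* a :+ (:- con (num 8)) :+ con (num 12)) refl

-- Since a = (a² - a)a⁻¹ + 1, vanishing of a² - a forces a = 1.
a²-a≢0 : ∀ a → a ≢ 0ℚ → a ≢ 1ℚ → a ℚ.* a ℚ.+ (- a) ≢ 0ℚ
a²-a≢0 a a≢0 a≢1 a²-a≡0 = a≢1 (begin
  a                                                  ≡⟨ ℚ.*-identityʳ a ⟨
  a ℚ.* 1ℚ                                           ≡⟨ ≡.cong (a ℚ.*_) (*-inv a a≢0) ⟨
  a ℚ.* (a ℚ.* inv a)                                ≡⟨ regroup a (inv a) ⟩
  (a ℚ.* a ℚ.+ (- a)) ℚ.* inv a ℚ.+ a ℚ.* inv a      ≡⟨ ≡.cong₂ (λ x y → x ℚ.* inv a ℚ.+ y) a²-a≡0 (*-inv a a≢0) ⟩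
  0ℚ ℚ.* inv a ℚ.+ 1ℚ                                ≡⟨ ≡.cong (ℚ._+ 1ℚ) (ℚ.*-zeroˡ (inv a)) ⟩
  1ℚ                                                 ∎)
  where
  open ≡-Reasoning
  open +-*-Solver
  regroup : ∀ a b → a ℚ.* (a ℚ.* b) ≡ (a ℚ.* a ℚ.+ (- a)) ℚ.* b ℚ.+ a ℚ.* b
  regroup = solve 2 (λ a b → a :* (a :* b) := (a :* a :+ (:- a)) :* b :+ a :* b) refl

-- Reducibility of f at a = 0 and a = 1.

constant⇒coeff-suc≡0 : ∀ p → IsDegree p 0 → ∀ n → coeff p (suc n) ≡ 0ℚ
constant⇒coeff-suc≡0 _ (_ , higher) n = higher (suc n) ℕ.z<s

X·nonconstant-reducible : ∀ f h n → (∀ k → coeff f k ≡ coeff ((0ℚ ∷ 1ℚ ∷ []) *ₚ h) k) →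
  coeff h (suc n) ≢ 0ℚ → ¬ Irreducible f
X·nonconstant-reducible f h n f≡Xh hₙ≢0 (_ , irr) with irr (0ℚ ∷ 1ℚ ∷ []) h f≡Xh
... | inj₁ deg-X = contradiction (constant⇒coeff-suc≡0 (0ℚ ∷ 1ℚ ∷ []) deg-X 0) λ ()
... | inj₂ deg-h = hₙ≢0 (constant⇒coeff-suc≡0 h deg-h n)

irreducible⇒≢0 : ∀ {a} → Irreducible (fPoly a) → a ≢ 0ℚ
-- Here f = 32x⁵ = x · 32x⁴; the index 3 points to the coefficient of x⁴, in degree `suc 3`.
irreducible⇒≢0 irr refl = X·nonconstant-reducible (fPoly 0ℚ) (0ℚ ∷ 0ℚ ∷ 0ℚ ∷ 0ℚ ∷ num 32 ∷ []) 3
  (λ { 0 → refl ; 1 → refl ; 2 → refl ; 3 → refl ; 4 → refl ; 5 → refl ; (suc (suc (suc (suc (suc (suc _)))))) → refl })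
  (λ ()) irr

irreducible⇒≢1 : ∀ {a} → Irreducible (fPoly a) → a ≢ 1ℚ
irreducible⇒≢1 irr refl = X·nonconstant-reducible (fPoly 1ℚ) (0ℚ ∷ 0ℚ ∷ 0ℚ ∷ 0ℚ ∷ num 36 ∷ []) 3
  (λ { 0 → refl ; 1 → refl ; 2 → refl ; 3 → refl ; 4 → refl ; 5 → refl ; (suc (suc (suc (suc (suc (suc _)))))) → refl })
  (λ ()) irr

-- Polynomial identities in a ℚ-algebra.

module ℚ-Algebra {c ℓ} (K : CommutativeRing c ℓ) (φ : ℚ → CommutativeRing.Carrier K)
  (isHom : IsRingHomomorphism +-*-rawRing (CommutativeRing.rawRing K) φ) where

  open CommutativeRing K hiding (zero) renaming (refl to ≈-refl; sym to ≈-sym; trans to ≈-trans)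
  open import Algebra.Properties.Group +-group using (x∙y⁻¹≈ε⇒x≈y; x≈y⇒x∙y⁻¹≈ε)
  private module φ = IsRingHomomorphism isHom

  -- Lets the solver compute with rational coefficients, whose equality is decidable, while its
  -- identities hold in K.
  morphism : +-*-rawRing -Raw-AlmostCommutative⟶ fromCommutativeRing K
  morphism = record
    { ⟦_⟧    = φ
    ; +-homo = φ.+-homo
    ; *-homo = φ.*-homo
    ; -‿homo = φ.-‿homo
    ; 0-homo = φ.0#-homo
    ; 1-homo = φ.1#-homo
    }

  open Algebra.Solver.Ring +-*-rawRing (fromCommutativeRing K) morphism
    (λ x y → Maybe.map φ.⟦⟧-cong (dec⇒maybe (x ℚ.≟ y)))

  private
    variable
      n : ℕ
      p q : Polynomial n
      x y : ℚ

  -- The same fold as `evalK`, on solver expressions, so that the two values can be matched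
  -- coefficient by coefficient.
  horner : List (Polynomial n) → Polynomial n → Polynomial n
  horner cs x = foldr (λ c acc → c :+ x :* acc) (con 0ℚ) cs

  -- A record rather than a synonym, so that x and p can be inferred.
  record Image (ρ : Vec Carrier n) (x : ℚ) (p : Polynomial n) : Set ℓ where
    constructor image
    field φ≈ : φ x ≈ ⟦ p ⟧ ρ
  open Image

  evalK-horner : ∀ {ρ : Vec Carrier n} {xs ps} → Pointwise (Image ρ) xs ps →
    ∀ p {α} → α ≈ ⟦ p ⟧ ρ → evalK K φ xs α ≈ ⟦ horner ps p ⟧ ρ
  evalK-horner []         p α≈p = ≈-sym φ.0#-homo
  evalK-horner (im ∷ ims) p α≈p = +-cong (φ≈ im) (*-cong α≈p (evalK-horner ims p α≈p))

  module _ {ρ : Vec Carrier n} where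
    infixl 7 _⊗_
    infixl 6 _⊕_
    infix  8 ⊖_

    const : Image ρ x (con x)
    const = image ≈-refl

    _⊕_ : Image ρ x p → Image ρ y q → Image ρ (x ℚ.+ y) (p :+ q)
    image i ⊕ image j = image (≈-trans (φ.+-homo _ _) (+-cong i j))

    _⊗_ : Image ρ x p → Image ρ y q → Image ρ (x ℚ.* y) (p :* q)
    image i ⊗ image j = image (≈-trans (φ.*-homo _ _) (*-cong i j))

    ⊖_ : Image ρ x p → Image ρ (ℚ.- x) (:- p)
    ⊖ image i = image (≈-trans (φ.-‿homo _) (-‿cong i))

  -- The expressions vanishing at ρ form an ideal. `_⟨+⟩_` and `_⟨*⟩_` are its closure rules, so a
  -- sum of generators times cofactors is certified term by term.
  record _∋_ (ρ : Vec Carrier n) (p : Polynomial n) : Set ℓ where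
    constructor vanishes
    field ≈0 : ⟦ p ⟧ ρ ≈ 0#
  open _∋_

  infixl 7 _⟨*⟩_
  infixl 6 _⟨+⟩_

  _⟨+⟩_ : ∀ {ρ : Vec Carrier n} → ρ ∋ p → ρ ∋ q → ρ ∋ (p :+ q)
  vanishes i ⟨+⟩ vanishes j = vanishes (≈-trans (+-cong i j) (+-identityˡ 0#))

  _⟨*⟩_ : ∀ {ρ : Vec Carrier n} → ρ ∋ p → ∀ q → ρ ∋ (p :* q)
  vanishes i ⟨*⟩ q = vanishes (≈-trans (*-congʳ i) (zeroˡ _))

  resp : ∀ {ρ : Vec Carrier n} → ⟦ p ⟧ ρ ≈ ⟦ q ⟧ ρ → ρ ∋ q → ρ ∋ p
  resp p≈q (vanishes q≈0) = vanishes (≈-trans p≈q q≈0)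

  cancel : ∀ {e e′ z} → e * e′ ≈ 1# → e * z ≈ 0# → z ≈ 0#
  cancel {e} {e′} {z} e*e′≈1 e*z≈0 = begin
    z              ≈⟨ *-identityˡ z ⟨
    1# * z         ≈⟨ *-congʳ e*e′≈1 ⟨
    e * e′ * z     ≈⟨ *-congʳ (*-comm e e′) ⟩
    e′ * e * z     ≈⟨ *-assoc e′ e z ⟩
    e′ * (e * z)   ≈⟨ *-congˡ e*z≈0 ⟩
    e′ * 0#        ≈⟨ zeroʳ e′ ⟩
    0#             ∎
    where open import Relation.Binary.Reasoning.Setoid setoid

  # : ℕ → Polynomial n
  # k = con (num k)

  infixl 8 _·_
  _·_ : ℕ → Polynomial n → Polynomial n
  k · p = # k :* p

  -- The polynomials of the family and their congruences modulo f.

  module Family (a : Polynomial n) where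
    a-1 a+8 a-4 D E : Polynomial n
    a-1 = a :- # 1
    a+8 = a :+ # 8
    a-4 = a :- # 4
    D   = a :* a :+ 4 · a :+ :- # 8
    E   = a :* a-1 :* D

    g₀ g₁ g₅ : Polynomial n
    g₀ = 2 · a :* a :+ :- (76 · a) :+ :- # 250
    g₁ = 10 · a :* a :+ 115 · a :+ :- # 125
    g₅ = a :* a :* a :+ 7 · a :* a :+ :- (8 · a)

    f g B N₂ N₄ Q₁ Q₂ Q₃ : Polynomial n → Polynomial n
    f = horner
      ( (:- (a :* a :* a) :+ a :* a)
      ∷ (:- (5 · a :* a) :+ 5 · a)
      ∷ con 0ℚ ∷ con 0ℚ ∷ con 0ℚ
      ∷ (4 · a :+ # 32) ∷ [])
    g = horner (g₀ ∷ g₁ ∷ con 0ℚ ∷ con 0ℚ ∷ con 0ℚ ∷ g₅ ∷ [])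
    B = horner
      ( :- (4 · (a :* a-1 :* a-4))
      ∷ 2 · (a :* a-1 :* (a :+ # 2))
      ∷ :- (2 · (a :* a-1 :* a+8))
      ∷ 8 · (a-1 :* a+8)
      ∷ 4 · (a+8 :* a-4) ∷ [])
    N₂ = horner
      ( :- (4 · (a :* a-1 :* a+8))
      ∷ :- (4 · (a :* a-1 :* (a :+ # 5)))
      ∷ 16 · (a-1 :* (a :+ # 5))
      ∷ :- (4 · (a+8 :* (a :+ # 2)))
      ∷ 4 · (a+8 :* a+8) ∷ [])
    N₄ = horner
      ( :- (8 · (a :* a :* a-1 :* (a :+ # 11)))
      ∷ 4 · (a :* (7 · a :* a :+ 16 · a :- # 50))
      ∷ 4 · (a :* (2 · a :* a :+ 5 · a :+ # 20))
      ∷ 4 · (a :* (a :* a :- 14 · a :- # 68))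
      ∷ 4 · (5 · a :* a :+ 92 · a :+ # 200) ∷ [])
    Q₁ = horner
      ( :- (4 · (a :* a-1 :* (a :* a :+ 16 · a :- # 8)))
      ∷ :- (4 · (a-1 :* a+8 :* (a :* a :- 8 · a :+ # 4)))
      ∷ 16 · (a-1 :* a+8 :* a-4)
      ∷ 4 · (a+8 :* a-4 :* a-4) ∷ [])
    Q₂ = horner
      ( :- (8 · (a-1 :* (a :+ # 5) :* (a :* a :+ 12 · a :+ # 8)))
      ∷ 36 · (a+8 :* (a :* a :+ 4 · a :- # 4))
      ∷ :- (8 · (a+8 :* a+8 :* (a :+ # 2)))
      ∷ 4 · (a+8 :* a+8 :* a+8) ∷ [])
    Q₃ = horner
      ( :- (2 · (a :* a :* a-1 :* horner (:- # 2160 ∷ # 1552 ∷ :- # 382 ∷ :- # 435 ∷ :- # 34 ∷ # 1 ∷ []) a))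
      ∷ 6 · (a :* a :* a-1 :* a+8 :* horner (# 104 ∷ :- # 108 ∷ :- # 51 ∷ # 1 ∷ []) a)
      ∷ 4 · (a :* a-1 :* a+8 :* horner (:- # 400 ∷ # 488 ∷ # 162 ∷ :- # 8 ∷ # 1 ∷ []) a)
      ∷ 4 · (a :* a-1 :* a+8 :* a-4 :* (5 · a :* a :+ 92 · a :+ # 200)) ∷ [])

  -- The variables A, X, Y stand for a, α, β.
  module _ {a α β e′ : Carrier} where
    private
      ρ : Vec Carrier 3
      ρ = a ∷ α ∷ β ∷ []

      A X Y : Polynomial 3
      A = var zero
      X = var (suc zero)
      Y = var (suc (suc zero))

      open Family A

      EY-B EY²-N₂ AEY⁴-N₄ : Polynomial 3
      EY-B    = E :* Y :- B X
      EY²-N₂  = E :* (Y :* Y) :- N₂ X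
      AEY⁴-N₄ = A :* E :* (Y :* Y :* (Y :* Y)) :- N₄ X

    root-transfer : ⟦ E ⟧ ρ * e′ ≈ 1# → ⟦ f X ⟧ ρ ≈ 0# → ⟦ EY-B ⟧ ρ ≈ 0# → ⟦ g Y ⟧ ρ ≈ 0#
    root-transfer E*e′≈1 f≈0 EY-B≈0 = ≈0 (÷E (÷E (÷E E³g)))
      where
      ÷E : ρ ∋ (E :* p) → ρ ∋ p
      ÷E (vanishes E*p≈0) = vanishes (cancel E*e′≈1 E*p≈0)

      vf : ρ ∋ f X
      vf = vanishes f≈0

      v₁ : ρ ∋ EY-B
      v₁ = vanishes EY-B≈0

      v₂ : ρ ∋ EY²-N₂
      v₂ = ÷E (resp
        -- E²Y² - B² = (EY - B)(EY + B), and B² - E N₂ = f Q₁: the remainder of B² modulo f is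
        -- divisible by E.
        (prove ρ (E :* EY²-N₂) (EY-B :* (E :* Y :+ B X) :+ f X :* Q₁ X) ≈-refl)
        (v₁ ⟨*⟩ (E :* Y :+ B X) ⟨+⟩ vf ⟨*⟩ Q₁ X))

      v₄ : ρ ∋ AEY⁴-N₄
      v₄ = ÷E (resp
        -- Again a difference of squares, now with A N₂² - E N₄ = A f Q₂; the factor A keeps N₄ free
        -- of denominators.
        (prove ρ (E :* AEY⁴-N₄) (EY²-N₂ :* (A :* (E :* (Y :* Y) :+ N₂ X)) :+ f X :* (A :* Q₂ X)) ≈-refl)
        (v₂ ⟨*⟩ (A :* (E :* (Y :* Y) :+ N₂ X)) ⟨+⟩ vf ⟨*⟩ (A :* Q₂ X)))

      AE²g : ρ ∋ (A :* E :* E :* g Y)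
      AE²g = resp
        -- The first two products replace A E Y⁴ by N₄, then E Y by B; the polynomial in A and X
        -- that is left is f Q₃.
        (prove ρ (A :* E :* E :* g Y)
          (AEY⁴-N₄ :* (g₅ :* E :* Y) :+ EY-B :* (g₅ :* N₄ X :+ g₁ :* A :* E) :+ f X :* Q₃ X) ≈-refl)
        (v₄ ⟨*⟩ (g₅ :* E :* Y) ⟨+⟩ v₁ ⟨*⟩ (g₅ :* N₄ X :+ g₁ :* A :* E) ⟨+⟩ vf ⟨*⟩ Q₃ X)

      E³g : ρ ∋ (E :* (E :* (E :* g Y)))
      E³g = resp
        -- As E = A(A - 1)D, this cofactor completes A to a third E, whose inverse is at hand.
        (prove ρ (E :* (E :* (E :* g Y))) (A :* E :* E :* g Y :* (a-1 :* D)) ≈-refl)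
        (AE²g ⟨*⟩ (a-1 :* D))

  -- Specialisation to the β of the theorem.

  unit-vanishes : ∀ {ρ : Vec Carrier n} → Image ρ x p → x ≡ 1ℚ → ρ ∋ (p :- con 1ℚ)
  unit-vanishes (image φx≈p) refl = vanishes (x≈y⇒x∙y⁻¹≈ε (≈-sym φx≈p))

  unit≈1 : ∀ {ρ : Vec Carrier n} p → ρ ∋ (p :- con 1ℚ) → ⟦ p ⟧ ρ ≈ 1#
  unit≈1 p (vanishes p-1≈0) = ≈-trans (x∙y⁻¹≈ε⇒x≈y _ _ p-1≈0) φ.1#-homo

  -- The variables A, X, d, u, v stand for a, α and the inverses of D, a² − a, a.
  module _ (a : ℚ) (a≢0 : a ≢ 0ℚ) (a≢1 : a ≢ 1ℚ) (α : Carrier) where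
    private
      σ : Vec Carrier 5
      σ = φ a ∷ α ∷ φ (inv (a ℚ.* a ℚ.+ num 4 ℚ.* a ℚ.+ (ℚ.- num 8))) ∷ φ (inv (a ℚ.* a ℚ.+ (ℚ.- a))) ∷ φ (inv a) ∷ []

      A X d u v : Polynomial 5
      A = var zero
      X = var (suc zero)
      d = var (suc (suc zero))
      u = var (suc (suc (suc zero)))
      v = var (suc (suc (suc (suc zero))))

      open Family A

      β : Polynomial 5
      β = horner
        ( d :* (:- (4 · A) :+ # 16)
        ∷ d :* (2 · A :+ # 4)
        ∷ d :* (:- (2 · A) :+ :- # 16)
        ∷ d :* ((8 · A :+ # 64) :* v)
        ∷ d :* ((4 · A :* A :+ 16 · A :+ :- # 128) :* u) ∷ []) X

      ιA : Image σ a A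
      ιA = image ≈-refl

      ιd : Image σ (inv (a ℚ.* a ℚ.+ num 4 ℚ.* a ℚ.+ (ℚ.- num 8))) d
      ιd = image ≈-refl

      ιu : Image σ (inv (a ℚ.* a ℚ.+ (ℚ.- a))) u
      ιu = image ≈-refl

      ιv : Image σ (inv a) v
      ιv = image ≈-refl

      -- The relations defining d, u and v are stated as p - 1 vanishing, to serve as ideal
      -- generators below.
      Dd-1 : σ ∋ (D :* d :- con 1ℚ)
      Dd-1 = unit-vanishes ((ιA ⊗ ιA ⊕ const ⊗ ιA ⊕ ⊖ const) ⊗ ιd) (*-inv _ (a²+4a-8≢0 a))

      [A²-A]u-1 : σ ∋ ((A :* A :+ :- A) :* u :- con 1ℚ)
      [A²-A]u-1 = unit-vanishes ((ιA ⊗ ιA ⊕ ⊖ ιA) ⊗ ιu) (*-inv _ (a²-a≢0 a a≢0 a≢1))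

      Av-1 : σ ∋ (A :* v :- con 1ℚ)
      Av-1 = unit-vanishes (ιA ⊗ ιv) (*-inv a a≢0)

    E-invertible : ⟦ E ⟧ σ * ⟦ d :* u ⟧ σ ≈ 1#
    E-invertible = unit≈1 (E :* (d :* u)) (resp
      -- With s = D d and t = (A² - A)u this is st - 1 = (s - 1)t + (t - 1).
      (prove σ (E :* (d :* u) :- con 1ℚ)
        ((D :* d :- con 1ℚ) :* ((A :* A :+ :- A) :* u) :+ ((A :* A :+ :- A) :* u :- con 1ℚ)) ≈-refl)
      (Dd-1 ⟨*⟩ ((A :* A :+ :- A) :* u) ⟨+⟩ [A²-A]u-1))

    clear-denominators : ⟦ E :* β :- B X ⟧ σ ≈ 0#
    clear-denominators = ≈0 {p = E :* β :- B X} (resp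
      -- E β = D d W, and W differs from B only by the factors A v and (A² - A)u, both equal to 1,
      -- in degrees 3 and 4.
      (prove σ (E :* β :- B X)
        ( (D :* d :- con 1ℚ) :* W :+ (A :* v :- con 1ℚ) :* (8 · (a-1 :* a+8) :* (X :* X :* X))
        :+ ((A :* A :+ :- A) :* u :- con 1ℚ) :* (4 · (a+8 :* a-4) :* (X :* X :* X :* X))) ≈-refl)
      ( Dd-1 ⟨*⟩ W ⟨+⟩ Av-1 ⟨*⟩ (8 · (a-1 :* a+8) :* (X :* X :* X))
      ⟨+⟩ [A²-A]u-1 ⟨*⟩ (4 · (a+8 :* a-4) :* (X :* X :* X :* X))))
      where
      W : Polynomial 5
      W = horner
        ( :- (4 · (A :* a-1 :* a-4))
        ∷ 2 · (A :* a-1 :* (A :+ # 2))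
        ∷ :- (2 · (A :* a-1 :* a+8))
        ∷ 8 · (a-1 :* a+8) :* (A :* v)
        ∷ 4 · (a+8 :* a-4) :* ((A :* A :+ :- A) :* u) ∷ []) X

    evalK-f : evalK K φ (fPoly a) α ≈ ⟦ f X ⟧ σ
    evalK-f = evalK-horner
      ( ((⊖ (ιA ⊗ ιA ⊗ ιA)) ⊕ ιA ⊗ ιA)
      ∷ ((⊖ (const ⊗ ιA ⊗ ιA)) ⊕ const ⊗ ιA)
      ∷ const ∷ const ∷ const
      ∷ (const ⊗ ιA ⊕ const) ∷ []) X ≈-refl

    evalK-β : evalK K φ (βPoly a) α ≈ ⟦ β ⟧ σ
    evalK-β = evalK-horner
      ( ιd ⊗ (⊖ (const ⊗ ιA) ⊕ const)
      ∷ ιd ⊗ (const ⊗ ιA ⊕ const)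
      ∷ ιd ⊗ (⊖ (const ⊗ ιA) ⊕ ⊖ const)
      ∷ ιd ⊗ ((const ⊗ ιA ⊕ const) ⊗ ιv)
      ∷ ιd ⊗ ((const ⊗ ιA ⊗ ιA ⊕ const ⊗ ιA ⊕ ⊖ const) ⊗ ιu) ∷ []) X ≈-refl

    evalK-g : evalK K φ (gPoly a) (evalK K φ (βPoly a) α) ≈ ⟦ g β ⟧ σ
    evalK-g = evalK-horner
      ( (const ⊗ ιA ⊗ ιA ⊕ ⊖ (const ⊗ ιA) ⊕ ⊖ const)
      ∷ (const ⊗ ιA ⊗ ιA ⊕ const ⊗ ιA ⊕ ⊖ const)
      ∷ const ∷ const ∷ const
      ∷ (ιA ⊗ ιA ⊗ ιA ⊕ const ⊗ ιA ⊗ ιA ⊕ ⊖ (const ⊗ ιA)) ∷ []) β evalK-β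

    g-root : evalK K φ (fPoly a) α ≈ 0# → evalK K φ (gPoly a) (evalK K φ (βPoly a) α) ≈ 0#
    g-root fα≈0 = ≈-trans evalK-g
      -- `Family` is generic in the number of variables, so expressions over (a, α, β) and over the
      -- five variables of σ unfold to the same elements of K.
      (root-transfer E-invertible (≈-trans (≈-sym evalK-f) fα≈0) clear-denominators)

theorem1p3 : ∀ {c ℓ} (K : CommutativeRing c ℓ) → IsField K
    → (φ : ℚ → CommutativeRing.Carrier K)
    → IsRingHomomorphism +-*-rawRing (CommutativeRing.rawRing K) φ
    → (a : ℚ) → a ≢ - num 8 → Irreducible (fPoly a)
    → (α : CommutativeRing.Carrier K)
    → CommutativeRing._≈_ K (evalK K φ (fPoly a) α) (CommutativeRing.0# K)
    → CommutativeRing._≈_ K (evalK K φ (gPoly a) (evalK K φ (βPoly a) α)) (CommutativeRing.0# K)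
theorem1p3 K _ φ isHom a _ irr α =
  ℚ-Algebra.g-root K φ isHom a (irreducible⇒≢0 irr) (irreducible⇒≢1 irr) α
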